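{- Let $k,n$ be integers with $2\le k\le n$. Then \[ S(n,n-k,k)=\binom{n}{k}-T(n,k+1,k). \] Moreover, if $k\le n-1$, then also $T(n,k+1,k)=C(n,n-k,n-k-1)$, so that $C(n,n-k,n-k-1)=\binom nk - S(n,n-k,k)$.
   Context: A CNF formula over variables $x_1,\dots,x_n$ is a conjunction of clauses, each clause a disjunction of literals (variables or negated variables); the width of a clause is its number of literals; a $k$-CNF is a CNF all of whose clauses have width at most $k$. For an assignment $a\in\{0,1\}^n$, $\mathrm{wt}(a)=\sum_i a_i$ is its Hamming weight. For a formula $F$, $\mathrm{sat}_t(F)$ is the set of satisfying assignments of $F$ of Hamming weight exactly $t$. $F$ is called $t$-admissible if it has no satisfying assignment of Hamming weight less than $t$. $S(n,t,k)$ is the maximum of $|\mathrm{sat}_t(F)|$ over all $t$-admissible $k$-CNF formulas $F$ on $n$ variables. A $k$-set system over a universe $U$ is a collection of $k$-element subsets of $U$; its size is the number of sets. The Turán number $T(n,q,k)$ is the size of the smallest $k$-set system $\mathcal S$ over $[n]$ such that every $q$-element subset of $[n]$ contains at least one member of $\mathcal S$ (if $q>n$ this is vacuous and $T(n,q,k)=0$). The covering number $C(n,q,k)$ is the size of the smallest $q$-set system $\mathcal S$ over $[n]$ such that every $k$-element subset of $[n]$ is contained in at least one member of $\mathcal S$. -}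

module Defs where

open import Data.Bool.Base using (Bool; true; false; if_then_else_)
import Data.Bool.Properties as Bool
open import Data.Fin.Base using (Fin)
open import Data.Fin.Subset using (Subset; ∣_∣; _⊆_)
open import Data.List.Base using (List; []; _∷_; length; filter; cartesianProductWith)
open import Data.List.Relation.Unary.All using (All; all?)
open import Data.List.Relation.Unary.Any using (Any; any?)
open import Data.List.Relation.Unary.Unique.Propositional using (Unique)
open import Data.Nat.Base using (ℕ; zero; suc; _≤_; _<_)
open import Data.Nat.Properties using (_≟_)
open import Data.Product.Base using (_×_; ∃-syntax)
open import Data.Vec.Base as Vec using (Vec)
open import Relation.Binary.PropositionalEquality using (_≡_)
open import Relation.Nullary using (¬_; Dec)
open import Relation.Nullary.Decidable using (_×-dec_)

IsMaximum : (ℕ → Set) → ℕ → Set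
IsMaximum P m = P m × (∀ j → P j → j ≤ m)

IsMinimum : (ℕ → Set) → ℕ → Set
IsMinimum P m = P m × (∀ j → P j → m ≤ j)

Assignment : ℕ → Set
Assignment n = Vec Bool n

wt : ∀ {n} → Assignment n → ℕ
wt a = Vec.sum (Vec.map (λ b → if b then 1 else 0) a)

assignments : ∀ n → List (Assignment n)
assignments zero    = Vec.[] ∷ []
assignments (suc n) = cartesianProductWith Vec._∷_ (false ∷ true ∷ []) (assignments n)

data Literal (n : ℕ) : Set where
  pos neg : Fin n → Literal n

-- Clauses may repeat a literal, and repetitions count towards the width.
-- Deleting them never increases the width nor changes the satisfying
-- assignments, so the maximum defining S does not depend on this choice.
Clause : ℕ → Set
Clause n = List (Literal n)

width : ∀ {n} → Clause n → ℕ
width = length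

CNF : ℕ → Set
CNF n = List (Clause n)

_-CNF : ℕ → ∀ {n} → CNF n → Set
(k -CNF) F = All (λ c → width c ≤ k) F

infix 4 _⊨ˡ_ _⊨_ _⊨ˡ?_ _⊨?_

_⊨ˡ_ : ∀ {n} → Assignment n → Literal n → Set
a ⊨ˡ pos i = Vec.lookup a i ≡ true
a ⊨ˡ neg i = Vec.lookup a i ≡ false

_⊨_ : ∀ {n} → Assignment n → CNF n → Set
a ⊨ F = All (Any (a ⊨ˡ_)) F

_⊨ˡ?_ : ∀ {n} (a : Assignment n) (l : Literal n) → Dec (a ⊨ˡ l)
a ⊨ˡ? pos i = Vec.lookup a i Bool.≟ true
a ⊨ˡ? neg i = Vec.lookup a i Bool.≟ false

_⊨?_ : ∀ {n} (a : Assignment n) (F : CNF n) → Dec (a ⊨ F)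
a ⊨? F = all? (any? (a ⊨ˡ?_)) F

sat : ∀ {n} → ℕ → CNF n → List (Assignment n)
sat t F = filter (λ a → (a ⊨? F) ×-dec (wt a ≟ t)) (assignments _)

Admissible : ∀ {n} → ℕ → CNF n → Set
Admissible t F = ∀ a → wt a < t → ¬ (a ⊨ F)

-- S, T and C are extrema over families that can be empty for some parameters
-- (for instance T(n,q,k) with q < k ≤ n), so they are given as relations:
-- `IsS n t k s` says that the maximum S(n,t,k) exists and equals s.  The value
-- is unique by antisymmetry of ≤.

IsS : (n t k s : ℕ) → Set
IsS n t k = IsMaximum λ m →
  ∃[ F ] (k -CNF) {n} F × Admissible t F × length (sat t F) ≡ m

record SetSystem (k n : ℕ) : Set where
  field
    sets     : List (Subset n)
    distinct : Unique sets
    uniform  : All (λ A → ∣ A ∣ ≡ k) sets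

  size : ℕ
  size = length sets

open SetSystem public

IsT : (n q k τ : ℕ) → Set
IsT n q k = IsMinimum λ m →
  ∃[ 𝒮 ] (∀ (Q : Subset n) → ∣ Q ∣ ≡ q → Any (_⊆ Q) (sets {k} 𝒮)) × size 𝒮 ≡ m

IsC : (n q k c : ℕ) → Set
IsC n q k = IsMinimum λ m →
  ∃[ 𝒮 ] (∀ (K : Subset n) → ∣ K ∣ ≡ k → Any (K ⊆_) (sets {q} 𝒮)) × size 𝒮 ≡ m

{-# OPTIONS --safe #-}
-- A set of k-subsets in which every (k+1)-subset has a member is the same thing
-- as the collection of zero sets, among those of size k, on which an
-- (n − k)-admissible k-CNF fails.  From a set system one takes the monotone
-- clauses ⋁_{i ∈ A} xᵢ.  Conversely, let Q have size k + 1; the assignment with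
-- zero set Q falsifies some clause, whose at most k literals miss some xᵢ with
-- i ∈ Q, so the assignment with zero set Q ∖ {i} still falsifies that clause.
-- Counting assignments of weight n − k gives S + T = C(n,k), and complementing
-- every set turns the Turán condition into the covering condition.
module Submission where

open import Defs
open import Data.Nat.Base using (ℕ; _≤_; _∸_; suc)
open import Data.Nat.Combinatorics using (_C_)
open import Data.Integer.Base using (+_; _-_)
open import Data.Product.Base using (_×_; ∃-syntax)
open import Relation.Binary.PropositionalEquality using (_≡_)

open import Data.Bool.Base using (true; false)
import Data.Bool.Properties as Bool
open import Data.Fin.Base using (Fin; zero; suc)
open import Data.Fin.Subset as Subset
  using (Subset; inside; outside; ∣_∣; _⊆_; ∁; Nonempty)
  renaming (_∈_ to _∈ˢ_; _∉_ to _∉ˢ_; _-_ to _∖_)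
open import Data.Fin.Subset.Properties as Subset
  using (_⊆?_; x∈∁p⇒x∉p; x∉∁p⇒x∈p; x∉p⇒x∈∁p; ∣∁p∣≡n∸∣p∣; ∣p∣≤n)
open import Data.Integer.Base using (_⊖_)
import Data.Integer.Properties as ℤ
open import Data.List.Base
  using (List; []; _∷_; _++_; length; filter; map)
open import Data.List.Extrema.Nat using (argmin; argmin-all; f[argmin]≤f[xs])
open import Data.List.Membership.Propositional using (_∈_; _∉_; find; lose)
open import Data.List.Membership.Propositional.Properties
  using (∈-filter⁺; ∈-filter⁻; ∈-map⁺; ∈-map⁻; ∈-++⁺ˡ; ∈-++⁺ʳ; ∈-cartesianProductWith⁺)
open import Data.List.Membership.Propositional.Properties.WithK using (unique∧set⇒bag)
open import Data.List.Properties
  using (length-map; length-++; filter-++; filter-≐; filter-none; ++-identityʳ)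
open import Data.List.Relation.Binary.BagAndSetEquality using (∼bag⇒↭)
open import Data.List.Relation.Binary.Permutation.Propositional.Properties using (↭-length)
import Data.List.Relation.Binary.Sublist.Propositional as Sublist
open import Data.List.Relation.Binary.Sublist.Propositional
  using ([]; _∷_; _∷ʳ_) renaming (_⊆_ to _⊑_)
open import Data.List.Relation.Binary.Sublist.Propositional.Properties using (All-resp-⊆)
import Data.List.Relation.Binary.Subset.Propositional as Lists
open import Data.List.Relation.Unary.All as All using (All; []; _∷_; all?)
import Data.List.Relation.Unary.All.Properties as All
open import Data.List.Relation.Unary.AllPairs using ([]; _∷_)
open import Data.List.Relation.Unary.Any as Any using (Any; here; there; any?)
import Data.List.Relation.Unary.Any.Properties as Any
open import Data.List.Relation.Unary.Unique.Propositional using (Unique)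
import Data.List.Relation.Unary.Unique.Propositional.Properties as Unique
open import Data.Nat.Base using (zero; _<_; _+_; s≤s; s≤s⁻¹)
open import Data.Nat.Combinatorics using (nCk≡nC[n∸k]; nCk+nC[k+1]≡[n+1]C[k+1])
open import Data.Nat.Properties
open import Data.Product.Base using (_,_; proj₁; proj₂)
open import Data.Vec.Base using ([]; _∷_; here; there)
import Data.Vec.Properties as Vec
open import Function.Base using (_∘_)
open import Function.Bundles using (mk⇔)
open import Level using (Level)
open import Relation.Binary.PropositionalEquality
  using (refl; sym; trans; cong; cong₂; subst; module ≡-Reasoning)
open import Relation.Nullary using (¬_; yes; no; ¬?; contradiction)
open import Relation.Nullary.Decidable using (_×-dec_; map′; decidable-stable; does)
open import Relation.Unary using (Pred; Decidable)

private
  variable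
    a p q : Level
    X Y : Set a
    n : ℕ

-- Duplicate-free lists, sublists and filtered counts.

Unique-set⇒length≡ : {xs ys : List X} → Unique xs → Unique ys →
                     xs Lists.⊆ ys → ys Lists.⊆ xs → length xs ≡ length ys
Unique-set⇒length≡ uxs uys xs⊆ys ys⊆xs =
  ↭-length (∼bag⇒↭ (unique∧set⇒bag uxs uys (mk⇔ xs⊆ys ys⊆xs)))

Unique-resp-⊒ : {xs ys : List X} → xs ⊑ ys → Unique ys → Unique xs
Unique-resp-⊒ []           []         = []
Unique-resp-⊒ (_ ∷ʳ xs⊑ys) (_ ∷ u)    = Unique-resp-⊒ xs⊑ys u
Unique-resp-⊒ (refl ∷ xs⊑ys) (x∉ ∷ u) = All-resp-⊆ xs⊑ys x∉ ∷ Unique-resp-⊒ xs⊑ys u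

sublists : List X → List (List X)
sublists []       = [] ∷ []
sublists (x ∷ xs) = map (x ∷_) (sublists xs) ++ sublists xs

sublists-⊑ : (xs : List X) → All (_⊑ xs) (sublists xs)
sublists-⊑ []       = [] ∷ []
sublists-⊑ (x ∷ xs) = All.++⁺ (All.map⁺ (All.map (refl ∷_) (sublists-⊑ xs)))
                              (All.map (x ∷ʳ_) (sublists-⊑ xs))

module _ {X : Set a} {P : Pred X p} (P? : Decidable P) where

  filter∈sublists : ∀ xs → filter P? xs ∈ sublists xs
  filter∈sublists []       = here refl
  filter∈sublists (x ∷ xs) with does (P? x)
  ... | true  = ∈-++⁺ˡ (∈-map⁺ (x ∷_) (filter∈sublists xs))
  ... | false = ∈-++⁺ʳ (map (x ∷_) (sublists xs)) (filter∈sublists xs)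

  length-filter-map : (f : Y → X) → ∀ ys →
                      length (filter P? (map f ys)) ≡ length (filter (P? ∘ f) ys)
  length-filter-map f []       = refl
  length-filter-map f (y ∷ ys) with does (P? (f y))
  ... | true  = cong suc (length-filter-map f ys)
  ... | false = length-filter-map f ys

  -- With `P` satisfaction of a formula and `Q` having weight `t`, the two filters on the left are
  -- literally `sat t F` and `unsat t F`.
  length-filter-split : {Q : Pred X q} (Q? : Decidable Q) → ∀ xs →
    length (filter (λ x → P? x ×-dec Q? x) xs) +
    length (filter (λ x → ¬? (P? x) ×-dec Q? x) xs) ≡ length (filter Q? xs)
  length-filter-split Q? []       = refl
  length-filter-split Q? (x ∷ xs) with does (P? x) | does (Q? x)
  ... | true  | true  = cong suc (length-filter-split Q? xs)
  ... | true  | false = length-filter-split Q? xs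
  ... | false | true  = trans (+-suc _ _) (cong suc (length-filter-split Q? xs))
  ... | false | false = length-filter-split Q? xs

-- Complements and cardinalities of finite sets.

∁-involutive : (A : Subset n) → ∁ (∁ A) ≡ A
∁-involutive []      = refl
∁-involutive (x ∷ A) = cong₂ _∷_ (Bool.not-involutive x) (∁-involutive A)

∁-injective : {A B : Subset n} → ∁ A ≡ ∁ B → A ≡ B
∁-injective {A = A} {B} eq =
  trans (sym (∁-involutive A)) (trans (cong ∁ eq) (∁-involutive B))

p⊆∁q⇒q⊆∁p : {A B : Subset n} → A ⊆ ∁ B → B ⊆ ∁ A
p⊆∁q⇒q⊆∁p A⊆∁B x∈B = x∉p⇒x∈∁p λ x∈A → x∈∁p⇒x∉p (A⊆∁B x∈A) x∈B

∁p⊆q⇒∁q⊆p : {A B : Subset n} → ∁ A ⊆ B → ∁ B ⊆ A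
∁p⊆q⇒∁q⊆p ∁A⊆B x∈∁B = x∉∁p⇒x∈p λ x∈∁A → x∈∁p⇒x∉p x∈∁B (∁A⊆B x∈∁A)

∣∁∣ : ∀ {k} (A : Subset n) → ∣ A ∣ ≡ k → ∣ ∁ A ∣ ≡ n ∸ k
∣∁∣ A refl = ∣∁p∣≡n∸∣p∣ A

p⊆q∧∣p∣≡∣q∣⇒p≡q : {A B : Subset n} → A ⊆ B → ∣ A ∣ ≡ ∣ B ∣ → A ≡ B
p⊆q∧∣p∣≡∣q∣⇒p≡q {A = A} {B} A⊆B eq = Subset.⊆-antisym A⊆B λ {x} x∈B →
  decidable-stable (x Subset.∈? A) λ x∉A →
    <⇒≢ (Subset.p⊂q⇒∣p∣<∣q∣ (A⊆B , x , x∈B , x∉A)) eq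

x∈p⇒1+∣p-x∣≡∣p∣ : ∀ {x} {A : Subset n} → x ∈ˢ A → suc ∣ A ∖ x ∣ ≡ ∣ A ∣
x∈p⇒1+∣p-x∣≡∣p∣ {A = _ ∷ A}       here       = cong (suc ∘ ∣_∣) (Subset.p─⊥≡p A)
x∈p⇒1+∣p-x∣≡∣p∣ {A = inside ∷ A}  (there x∈) = cong suc (x∈p⇒1+∣p-x∣≡∣p∣ x∈)
x∈p⇒1+∣p-x∣≡∣p∣ {A = outside ∷ A} (there x∈) = x∈p⇒1+∣p-x∣≡∣p∣ x∈

x∉p-x : ∀ x (A : Subset n) → x ∉ˢ A ∖ x
x∉p-x (suc x) (_ ∷ A) (there x∈) = x∉p-x x A x∈

0<∣p∣⇒Nonempty : (A : Subset n) → 0 < ∣ A ∣ → Nonempty A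
0<∣p∣⇒Nonempty (inside  ∷ A) _ = zero , here
0<∣p∣⇒Nonempty (outside ∷ A) 0<∣A∣ =
  let x , x∈A = 0<∣p∣⇒Nonempty A 0<∣A∣ in suc x , there x∈A

m≤∣p∣⇒∃q⊆p : ∀ m (A : Subset n) → m ≤ ∣ A ∣ → ∃[ B ] B ⊆ A × ∣ B ∣ ≡ m
m≤∣p∣⇒∃q⊆p {n} zero A _ = Subset.⊥ , Subset.⊆-min A , Subset.∣⊥∣≡0 n
m≤∣p∣⇒∃q⊆p (suc m) (outside ∷ A) m<∣A∣ =
  let B , B⊆A , ∣B∣ = m≤∣p∣⇒∃q⊆p (suc m) A m<∣A∣
  in outside ∷ B , Subset.out⊆ B⊆A , ∣B∣
m≤∣p∣⇒∃q⊆p (suc m) (inside ∷ A) (s≤s m≤∣A∣) =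
  let B , B⊆A , ∣B∣ = m≤∣p∣⇒∃q⊆p m A m≤∣A∣
  in inside ∷ B , Subset.in⊆in B⊆A , cong suc ∣B∣

-- Enumerating and counting the subsets of a given size.

∈-assignments : (A : Assignment n) → A ∈ assignments n
∈-assignments []          = here refl
∈-assignments (false ∷ A) =
  ∈-cartesianProductWith⁺ _∷_ {xs = false ∷ true ∷ []} (here refl) (∈-assignments A)
∈-assignments (true  ∷ A) =
  ∈-cartesianProductWith⁺ _∷_ {xs = false ∷ true ∷ []} (there (here refl)) (∈-assignments A)

assignments-Unique : ∀ n → Unique (assignments n)
assignments-Unique zero    = [] ∷ []
assignments-Unique (suc n) = Unique.cartesianProductWith⁺ _∷_ Vec.∷-injective
  (((λ ()) ∷ []) ∷ [] ∷ []) (assignments-Unique n)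

-- `Subset n` and `Assignment n` are both `Vec Bool n`: an assignment is the set of its true
-- variables, and one enumeration serves both.
subsets : ∀ k n → List (Subset n)
subsets k n = filter (λ A → ∣ A ∣ ≟ k) (assignments n)

∈-subsets⁺ : ∀ {k} {A : Subset n} → ∣ A ∣ ≡ k → A ∈ subsets k n
∈-subsets⁺ {A = A} = ∈-filter⁺ _ (∈-assignments A)

subsets-Unique : ∀ k n → Unique (subsets k n)
subsets-Unique k n = Unique.filter⁺ _ (assignments-Unique n)

subsets-uniform : ∀ k n → All (λ A → ∣ A ∣ ≡ k) (subsets k n)
subsets-uniform k n = All.all-filter _ (assignments n)

-- Pascal's rule, by whether the first element belongs to the set.
length-subsets : ∀ k n → length (subsets k n) ≡ n C k
length-subsets zero    zero    = refl
length-subsets (suc k) zero    = refl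
length-subsets k       (suc n) = begin
  length (filter P? (map (false ∷_) as ++ map (true ∷_) as ++ []))
    ≡⟨ cong (λ bs → length (filter P? (map (false ∷_) as ++ bs))) (++-identityʳ _) ⟩
  length (filter P? (map (false ∷_) as ++ map (true ∷_) as))
    ≡⟨ cong length (filter-++ P? (map (false ∷_) as) _) ⟩
  length (filter P? (map (false ∷_) as) ++ filter P? (map (true ∷_) as))
    ≡⟨ length-++ (filter P? (map (false ∷_) as)) ⟩
  length (filter P? (map (false ∷_) as)) + length (filter P? (map (true ∷_) as))
    ≡⟨ cong₂ _+_ (length-filter-map P? (false ∷_) as) (length-filter-map P? (true ∷_) as) ⟩
  length (subsets k n) + length (filter (λ A → suc ∣ A ∣ ≟ k) as)
    ≡⟨ pascal k ⟩
  suc n C k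
    ∎
  where
  open ≡-Reasoning
  as : List (Subset n)
  as = assignments n
  P? : Decidable (λ (A : Subset (suc n)) → ∣ A ∣ ≡ k)
  P? A = ∣ A ∣ ≟ k
  -- Only the sets containing the first element depend on the shape of `k`: there are none for zero,
  -- and their tails are the `k`-subsets for `suc k`.
  pascal : ∀ k → length (subsets k n) + length (filter (λ A → suc ∣ A ∣ ≟ k) as) ≡ suc n C k
  pascal zero = begin
    length (subsets 0 n) + length (filter (λ A → suc ∣ A ∣ ≟ 0) as)
      ≡⟨ cong₂ _+_ (length-subsets 0 n)
           (cong length (filter-none (λ A → suc ∣ A ∣ ≟ 0) (All.universal (λ _ ()) as))) ⟩
    n C 0 + 0
      ≡⟨ +-identityʳ _ ⟩
    suc n C 0
      ∎
  pascal (suc k) = begin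
    length (subsets (suc k) n) + length (filter (λ A → suc ∣ A ∣ ≟ suc k) as)
      ≡⟨ cong (λ bs → length (subsets (suc k) n) + length bs)
           (filter-≐ _ _ (suc-injective , cong suc) as) ⟩
    length (subsets (suc k) n) + length (subsets k n)
      ≡⟨ cong₂ _+_ (length-subsets (suc k) n) (length-subsets k n) ⟩
    n C suc k + n C k
      ≡⟨ +-comm (n C suc k) (n C k) ⟩
    n C k + n C suc k
      ≡⟨ nCk+nC[k+1]≡[n+1]C[k+1] n k ⟩
    suc n C suc k
      ∎

-- Weight as cardinality, and sets as lists of elements.

wt≡∣∣ : (A : Assignment n) → wt A ≡ ∣ A ∣
wt≡∣∣ []          = refl
wt≡∣∣ (false ∷ A) = wt≡∣∣ A
wt≡∣∣ (true  ∷ A) = cong suc (wt≡∣∣ A)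

elements : Subset n → List (Fin n)
elements []            = []
elements (inside  ∷ A) = zero ∷ map suc (elements A)
elements (outside ∷ A) = map suc (elements A)

length-elements : (A : Subset n) → length (elements A) ≡ ∣ A ∣
length-elements []            = refl
length-elements (inside  ∷ A) = cong suc (trans (length-map suc (elements A)) (length-elements A))
length-elements (outside ∷ A) = trans (length-map suc (elements A)) (length-elements A)

∈-elements⁺ : ∀ {i} {A : Subset n} → i ∈ˢ A → i ∈ elements A
∈-elements⁺ here                           = here refl
∈-elements⁺ {A = inside  ∷ A} (there i∈A) = there (∈-map⁺ suc (∈-elements⁺ i∈A))
∈-elements⁺ {A = outside ∷ A} (there i∈A) = ∈-map⁺ suc (∈-elements⁺ i∈A)

∈-elements⁻ : ∀ {i} (A : Subset n) → i ∈ elements A → i ∈ˢ A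
∈-elements⁻ (inside ∷ A) (here refl) = here
∈-elements⁻ (inside ∷ A) (there i∈) with _ , j∈ , refl ← ∈-map⁻ suc i∈ =
  there (∈-elements⁻ A j∈)
∈-elements⁻ (outside ∷ A) i∈ with _ , j∈ , refl ← ∈-map⁻ suc i∈ =
  there (∈-elements⁻ A j∈)

-- A finite search through the sublists of `subsets k n`. Any competing system can be relisted as
-- such a sublist of the same size, and `mono` carries `P` over to it.
minimalSystem : ∀ {k} {P : Pred (List (Subset n)) p} → Decidable P →
  (∀ {xs ys} → xs Lists.⊆ ys → P xs → P ys) → P (subsets k n) →
  ∃[ 𝒮 ] P (sets {k} {n} 𝒮) × (∀ 𝒮′ → P (sets {k} {n} 𝒮′) → size 𝒮 ≤ size 𝒮′)
minimalSystem {n = n} {k = k} {P = P} P? mono Pall = 𝒮 , proj₁ best-good , minimal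
  where
  candidates : List (List (Subset n))
  candidates = filter P? (sublists (subsets k n))
  best : List (Subset n)
  -- The default `subsets k n` satisfies `P` by `Pall`, so `best` is good whichever list `argmin`
  -- returns.
  best = argmin length (subsets k n) candidates
  best-good : P best × best ⊑ subsets k n
  best-good = argmin-all length {P = λ xs → P xs × xs ⊑ subsets k n} (Pall , Sublist.⊆-refl)
    (All.tabulate λ xs∈ → let xs∈sublists , Pxs = ∈-filter⁻ P? xs∈ in
      Pxs , All.lookup (sublists-⊑ (subsets k n)) xs∈sublists)
  𝒮 : SetSystem k n
  𝒮 = record
    { sets     = best
    ; distinct = Unique-resp-⊒ (proj₂ best-good) (subsets-Unique k n)
    ; uniform  = All-resp-⊆ (proj₂ best-good) (subsets-uniform k n)
    }
  minimal : ∀ 𝒮′ → P (sets {k} 𝒮′) → length best ≤ size 𝒮′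
  minimal 𝒮′ P𝒮′ = begin
    length best       ≤⟨ All.lookup (f[argmin]≤f[xs] {f = length} (subsets k n) candidates)
                           (∈-filter⁺ P? (filter∈sublists ∈𝒮′? (subsets k n)) (mono 𝒮′⊆ P𝒮′)) ⟩
    length normalised ≡⟨ Unique-set⇒length≡ (Unique.filter⁺ ∈𝒮′? (subsets-Unique k n))
                           (distinct 𝒮′) (proj₂ ∘ ∈-filter⁻ ∈𝒮′? {xs = subsets k n}) 𝒮′⊆ ⟩
    size 𝒮′           ∎
    where
    open ≤-Reasoning
    ∈𝒮′? : Decidable (_∈ sets 𝒮′)
    ∈𝒮′? A = any? (Vec.≡-dec Bool._≟_ A) (sets 𝒮′)
    -- The members of `𝒮′` in the order of the enumeration; with `mono` this is one of the
    -- `candidates`.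
    normalised : List (Subset n)
    normalised = filter ∈𝒮′? (subsets k n)
    𝒮′⊆ : sets 𝒮′ Lists.⊆ normalised
    𝒮′⊆ A∈ = ∈-filter⁺ ∈𝒮′? (∈-subsets⁺ (All.lookup (uniform 𝒮′) A∈)) A∈

-- Turán systems and covering systems.

Turán : ℕ → List (Subset n) → Set
Turán {n} q 𝒜 = ∀ (Q : Subset n) → ∣ Q ∣ ≡ q → Any (_⊆ Q) 𝒜

Turán? : ∀ q → Decidable (Turán {n} q)
Turán? {n} q 𝒜 = map′ (λ all Q ∣Q∣ → All.lookup all (∈-subsets⁺ ∣Q∣))
  (λ turán → All.tabulate λ {Q} Q∈ → turán Q (All.lookup (subsets-uniform q n) Q∈))
  (all? (λ Q → any? (_⊆? Q) 𝒜) (subsets q n))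

-- Feasibility, which makes the minimum exist.
subsets-Turán : ∀ {k q} → k ≤ q → Turán {n} q (subsets k n)
subsets-Turán {k = k} k≤q Q refl with B , B⊆Q , ∣B∣ ← m≤∣p∣⇒∃q⊆p k Q k≤q =
  lose (∈-subsets⁺ ∣B∣) B⊆Q

complement : ∀ {k j} → n ∸ k ≡ j → SetSystem k n → SetSystem j n
complement n∸k≡j 𝒮 = record
  { sets     = map ∁ (sets 𝒮)
  ; distinct = Unique.map⁺ ∁-injective (distinct 𝒮)
  ; uniform  = All.map⁺ (All.map (λ {A} ∣A∣ → trans (∣∁∣ A ∣A∣) n∸k≡j) (uniform 𝒮))
  }

size-complement : ∀ {k j} (eq : n ∸ k ≡ j) (𝒮 : SetSystem k n) → size (complement eq 𝒮) ≡ size 𝒮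
size-complement _ 𝒮 = length-map ∁ (sets 𝒮)

-- `A ⊆ Q` is equivalent to `∁ Q ⊆ ∁ A`, so complementing members and test sets preserves sizes and
-- exchanges the two conditions. The bounds make `n ∸ (n ∸ q)` and `n ∸ (n ∸ k)` return `q` and `k`.
IsT⇒IsC : ∀ {q k c} → q ≤ n → k ≤ n → IsT n q k c → IsC n (n ∸ k) (n ∸ q) c
IsT⇒IsC {n} {q} {k} {c} q≤n k≤n ((𝒮 , turán , size𝒮) , minimal) =
  (complement refl 𝒮 , covers , trans (size-complement refl 𝒮) size𝒮) , minimal′
  where
  covers : ∀ (K : Subset n) → ∣ K ∣ ≡ n ∸ q → Any (K ⊆_) (map ∁ (sets 𝒮))
  covers K ∣K∣ = Any.map⁺ (Any.map {P = _⊆ ∁ K} {Q = λ A → K ⊆ ∁ A} (λ A⊆∁K → p⊆∁q⇒q⊆∁p A⊆∁K)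
    (turán (∁ K) (trans (∣∁∣ K ∣K∣) (m∸[m∸n]≡n q≤n))))
  minimal′ : ∀ j → ∃[ 𝒮′ ] (∀ (K : Subset n) → ∣ K ∣ ≡ n ∸ q → Any (K ⊆_) (sets {n ∸ k} 𝒮′)) ×
                            size 𝒮′ ≡ j → c ≤ j
  minimal′ j (𝒮′ , covers′ , size𝒮′) = minimal j
    ( complement (m∸[m∸n]≡n k≤n) 𝒮′
    , (λ Q ∣Q∣ → Any.map⁺ (Any.map {P = ∁ Q ⊆_} {Q = λ A → ∁ A ⊆ Q} (λ ∁Q⊆A → ∁p⊆q⇒∁q⊆p ∁Q⊆A) (covers′ (∁ Q) (∣∁∣ Q ∣Q∣))))
    , trans (size-complement (m∸[m∸n]≡n k≤n) 𝒮′) size𝒮′)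

-- Counting falsifying assignments.

unsat : ℕ → CNF n → List (Assignment n)
unsat t F = filter (λ A → ¬? (A ⊨? F) ×-dec (wt A ≟ t)) (assignments _)

∈-unsat⁺ : ∀ {t} {F : CNF n} {A} → ¬ (A ⊨ F) → ∣ A ∣ ≡ t → A ∈ unsat t F
∈-unsat⁺ {A = A} A⊭F ∣A∣ = ∈-filter⁺ _ (∈-assignments A) (A⊭F , trans (wt≡∣∣ A) ∣A∣)

∈-unsat⁻ : ∀ {t} (F : CNF n) {A} → A ∈ unsat t F → ¬ (A ⊨ F) × ∣ A ∣ ≡ t
∈-unsat⁻ {n} {t} F {A} A∈
  with _ , A⊭F , wtA ← ∈-filter⁻ (λ A → ¬? (A ⊨? F) ×-dec (wt A ≟ t)) {xs = assignments n} A∈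
  = A⊭F , trans (sym (wt≡∣∣ A)) wtA

sat+unsat : ∀ t (F : CNF n) → length (sat t F) + length (unsat t F) ≡ n C t
sat+unsat {n} t F = begin
  length (sat t F) + length (unsat t F)
    ≡⟨ length-filter-split (_⊨? F) (λ A → wt A ≟ t) (assignments n) ⟩
  length (filter (λ A → wt A ≟ t) (assignments n))
    ≡⟨ cong length (filter-≐ _ _ ((λ {A} → trans (sym (wt≡∣∣ A))) , λ {A} → trans (wt≡∣∣ A))
         (assignments n)) ⟩
  length (subsets t n)
    ≡⟨ length-subsets t n ⟩
  n C t
    ∎
  where open ≡-Reasoning

-- From set systems to monotone formulas.

monotoneClause : Subset n → Clause n
monotoneClause A = map pos (elements A)

width-monotoneClause : (A : Subset n) → width (monotoneClause A) ≡ ∣ A ∣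
width-monotoneClause A = trans (length-map pos (elements A)) (length-elements A)

falsified⇒⊆∁ : (A B : Subset n) → ¬ Any (B ⊨ˡ_) (monotoneClause A) → A ⊆ ∁ B
falsified⇒⊆∁ A B B⊭A {i} i∈A = x∉p⇒x∈∁p λ i∈B →
  B⊭A (lose (∈-map⁺ pos (∈-elements⁺ i∈A)) (Vec.[]=⇒lookup i∈B))

⊆∁⇒falsified : (A B : Subset n) → A ⊆ ∁ B → ¬ Any (B ⊨ˡ_) (monotoneClause A)
⊆∁⇒falsified A B A⊆∁B B⊨A with i , i∈A , Bᵢ ← find (Any.map⁻ B⊨A) =
  x∈∁p⇒x∉p (A⊆∁B (∈-elements⁻ A i∈A)) (Vec.lookup⇒[]= i B Bᵢ)

monotoneCNF : List (Subset n) → CNF n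
monotoneCNF = map monotoneClause

⊭monotoneCNF⇒ : (𝒜 : List (Subset n)) (B : Assignment n) →
                ¬ (B ⊨ monotoneCNF 𝒜) → Any (_⊆ ∁ B) 𝒜
⊭monotoneCNF⇒ 𝒜 B B⊭ = Any.map {Q = _⊆ ∁ B} (λ {A} B⊭A → falsified⇒⊆∁ A B B⊭A)
  (Any.map⁻ (All.¬All⇒Any¬ (any? (B ⊨ˡ?_)) _ B⊭))

⊭monotoneCNF⇐ : (𝒜 : List (Subset n)) (B : Assignment n) →
                Any (_⊆ ∁ B) 𝒜 → ¬ (B ⊨ monotoneCNF 𝒜)
⊭monotoneCNF⇐ 𝒜 B any =
  All.Any¬⇒¬All (Any.map⁺ (Any.map {P = _⊆ ∁ B} (λ {A} A⊆∁B → ⊆∁⇒falsified A B A⊆∁B) any))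

monotoneCNF-width : ∀ {k} (𝒮 : SetSystem k n) → (k -CNF) (monotoneCNF (sets 𝒮))
monotoneCNF-width 𝒮 = All.map⁺ (All.map
  (λ {A} ∣A∣ → ≤-reflexive (trans (width-monotoneClause A) ∣A∣)) (uniform 𝒮))

m<n∸k⇒k<n∸m : ∀ {m n k} → k ≤ n → m < n ∸ k → k < n ∸ m
m<n∸k⇒k<n∸m {m} {n} {k} k≤n m<n∸k = m+n≤o⇒m≤o∸n (suc k) (begin
  suc k + m   ≡⟨ +-suc k m ⟨
  k + suc m   ≤⟨ +-monoʳ-≤ k m<n∸k ⟩
  k + (n ∸ k) ≡⟨ m+[n∸m]≡n k≤n ⟩
  n           ∎)
  where open ≤-Reasoning

-- Fewer than `n ∸ k` ones leave at least `k + 1` zeros; a member of `𝒜` inside `k + 1` of them is a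
-- falsified clause.
monotoneCNF-admissible : ∀ {k} {𝒜 : List (Subset n)} → k ≤ n → Turán (suc k) 𝒜 →
                         Admissible (n ∸ k) (monotoneCNF 𝒜)
monotoneCNF-admissible {n} {k} {𝒜} k≤n turán B wtB<n∸k
  with Q , Q⊆∁B , ∣Q∣ ← m≤∣p∣⇒∃q⊆p (suc k) (∁ B)
         (subst (k <_) (sym (∣∁p∣≡n∸∣p∣ B))
           (m<n∸k⇒k<n∸m k≤n (subst (_< n ∸ k) (wt≡∣∣ B) wtB<n∸k)))
  = ⊭monotoneCNF⇐ 𝒜 B (Any.map {P = _⊆ Q} {Q = _⊆ ∁ B} (λ A⊆Q → Subset.⊆-trans A⊆Q Q⊆∁B) (turán Q ∣Q∣))

-- At weight `n ∸ k` the zero set has exactly `k` elements, so a member contained in it equals it.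
-- The falsifying assignments of this weight are thus the complements of the members.
length-unsat-monotoneCNF : ∀ {k} → k ≤ n → (𝒮 : SetSystem k n) →
                           length (unsat (n ∸ k) (monotoneCNF (sets 𝒮))) ≡ size 𝒮
length-unsat-monotoneCNF {n} {k} k≤n 𝒮 = trans
  (Unique-set⇒length≡ (Unique.filter⁺ _ (assignments-Unique n)) (distinct (complement refl 𝒮))
    unsat⊆ ⊆unsat)
  (size-complement refl 𝒮)
  where
  F : CNF n
  F = monotoneCNF (sets 𝒮)
  unsat⊆ : unsat (n ∸ k) F Lists.⊆ map ∁ (sets 𝒮)
  unsat⊆ {B} B∈
    with B⊭F , ∣B∣ ← ∈-unsat⁻ F B∈
    with A , A∈ , A⊆∁B ← find (⊭monotoneCNF⇒ (sets 𝒮) B B⊭F)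
    = subst (_∈ map ∁ (sets 𝒮)) (trans (cong ∁ A≡∁B) (∁-involutive B)) (∈-map⁺ ∁ A∈)
    where
    A≡∁B : A ≡ ∁ B
    A≡∁B = p⊆q∧∣p∣≡∣q∣⇒p≡q A⊆∁B
      (trans (All.lookup (uniform 𝒮) A∈) (sym (trans (∣∁∣ B ∣B∣) (m∸[m∸n]≡n k≤n))))
  ⊆unsat : map ∁ (sets 𝒮) Lists.⊆ unsat (n ∸ k) F
  ⊆unsat B∈ with A , A∈ , refl ← ∈-map⁻ ∁ B∈ = ∈-unsat⁺
    (⊭monotoneCNF⇐ (sets 𝒮) (∁ A) (lose A∈ (Subset.⊆-reflexive (sym (∁-involutive A)))))
    (∣∁∣ A (All.lookup (uniform 𝒮) A∈))

-- From admissible formulas to Turán systems.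

-- A positive literal on an element of `Q` uses up that element, lowering width and size together;
-- any other literal lowers only the width, so the strict inequality survives. Only positive
-- occurrences need avoiding: for `i` in `Q`, `neg i` is true under `∁ Q`, so a clause falsified
-- there has no such literal.
freeVariable : (c : Clause n) (Q : Subset n) → width c < ∣ Q ∣ → ∃[ i ] i ∈ˢ Q × pos i ∉ c
freeVariable [] Q 0<∣Q∣ with i , i∈Q ← 0<∣p∣⇒Nonempty Q 0<∣Q∣ = i , i∈Q , λ ()
freeVariable (neg j ∷ c) Q c<∣Q∣ with i , i∈Q , i∉c ← freeVariable c Q (<-trans (n<1+n _) c<∣Q∣) =
  i , i∈Q , λ { (there i∈c) → i∉c i∈c }
freeVariable (pos j ∷ c) Q c<∣Q∣ with j Subset.∈? Q
... | no j∉Q with i , i∈Q , i∉c ← freeVariable c Q (<-trans (n<1+n _) c<∣Q∣) =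
  i , i∈Q , λ { (here refl) → j∉Q i∈Q ; (there i∈c) → i∉c i∈c }
... | yes j∈Q
  with i , i∈Q-j , i∉c ← freeVariable c (Q ∖ j)
         (s≤s⁻¹ (subst (suc (suc (width c)) ≤_) (sym (x∈p⇒1+∣p-x∣≡∣p∣ j∈Q)) c<∣Q∣)) =
  i , Subset.p─q⊆p Q Subset.⁅ j ⁆ i∈Q-j ,
  λ { (here refl) → x∉p-x i Q i∈Q-j ; (there i∈c) → i∉c i∈c }

-- Raising xᵢ in a falsified clause keeps it falsified when xᵢ is not among its
-- literals: every other positive literal is unchanged and every negative
-- literal was false because its variable is already true.
falsified-remove : ∀ {i} (c : Clause n) (Q : Subset n) → pos i ∉ c →
                   ¬ Any (∁ Q ⊨ˡ_) c → ¬ Any (∁ (Q ∖ i) ⊨ˡ_) c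
falsified-remove {i = i} c Q i∉c ∁Q⊭c ⊨c with l , l∈c , ⊨l ← find ⊨c = by-literal l l∈c ⊨l
  where
  by-literal : ∀ l → l ∈ c → ¬ (∁ (Q ∖ i) ⊨ˡ l)
  by-literal (pos j) j∈c ⊨j = ∁Q⊭c (lose j∈c (Vec.[]=⇒lookup (x∉p⇒x∈∁p λ j∈Q →
    x∈∁p⇒x∉p (Vec.lookup⇒[]= j (∁ (Q ∖ i)) ⊨j)
      (Subset.x∈p∧x≢y⇒x∈p-y j∈Q λ { refl → i∉c j∈c }))))
  by-literal (neg j) j∈c ⊨j = ∁Q⊭c (lose j∈c (Bool.¬-not λ j∈∁Q →
    contradiction (trans (sym ⊨j) (Vec.[]=⇒lookup
      (Subset.p⊆q⇒∁p⊇∁q (Subset.p─q⊆p Q Subset.⁅ i ⁆) (Vec.lookup⇒[]= j (∁ Q) j∈∁Q)))) λ ()))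

-- `unsat` lists the sets of ones, while the members wanted are the zero sets; hence the complement.
unsatSystem : ∀ {k} → k ≤ n → CNF n → SetSystem k n
unsatSystem {n} {k} k≤n F = complement (m∸[m∸n]≡n k≤n) record
  { sets     = unsat (n ∸ k) F
  ; distinct = Unique.filter⁺ _ (assignments-Unique n)
  ; uniform  = All.tabulate (proj₂ ∘ ∈-unsat⁻ F)
  }

falsifiedClause : ∀ {k} (F : CNF n) → Admissible (n ∸ k) F → (Q : Subset n) → ∣ Q ∣ ≡ suc k →
                  ∃[ c ] c ∈ F × ¬ Any (∁ Q ⊨ˡ_) c
falsifiedClause {n} {k} F admissible Q ∣Q∣ =
  find (All.¬All⇒Any¬ (any? (∁ Q ⊨ˡ?_)) F (admissible (∁ Q) wt∁Q<n∸k))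
  where
  wt∁Q<n∸k : wt (∁ Q) < n ∸ k
  wt∁Q<n∸k = subst (_< n ∸ k) (sym (trans (wt≡∣∣ (∁ Q)) (∣∁∣ Q ∣Q∣)))
    -- Truncated subtraction is strict here because `suc k ≤ n`, which the existence of `Q`
    -- guarantees.
    (∸-monoʳ-< (n<1+n k) (subst (_≤ n) ∣Q∣ (∣p∣≤n Q)))

unsatSystem-Turán : ∀ {k} (k≤n : k ≤ n) (F : CNF n) → (k -CNF) F → Admissible (n ∸ k) F →
                    Turán (suc k) (sets (unsatSystem k≤n F))
unsatSystem-Turán {n} {k} k≤n F kCNF admissible Q ∣Q∣
  with c , c∈F , ∁Q⊭c ← falsifiedClause F admissible Q ∣Q∣
  with i , i∈Q , i∉c ← freeVariable c Q (subst (width c <_) (sym ∣Q∣) (s≤s (All.lookup kCNF c∈F)))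
  -- The member inside `Q` is `Q ∖ i`, which occurs in the system as the complement of the
  -- falsifying assignment `∁ (Q ∖ i)`.
  = lose (∈-map⁺ ∁ (∈-unsat⁺ ∁[Q∖i]⊭F (∣∁∣ (Q ∖ i) ∣Q∖i∣)))
      (subst (_⊆ Q) (sym (∁-involutive (Q ∖ i))) (Subset.p─q⊆p Q Subset.⁅ i ⁆))
  where
  ∣Q∖i∣ : ∣ Q ∖ i ∣ ≡ k
  ∣Q∖i∣ = suc-injective (trans (x∈p⇒1+∣p-x∣≡∣p∣ i∈Q) ∣Q∣)
  ∁[Q∖i]⊭F : ¬ (∁ (Q ∖ i) ⊨ F)
  ∁[Q∖i]⊭F ⊨F = falsified-remove c Q i∉c ∁Q⊭c (All.lookup ⊨F c∈F)

-- Combining the counts.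

m+n≡o⇒+m≡+o-+n : ∀ m n {o} → m + n ≡ o → + m ≡ + o - + n
m+n≡o⇒+m≡+o-+n m n refl = sym (begin
  + (m + n) - + n ≡⟨ ℤ.m-n≡m⊖n (m + n) n ⟩
  (m + n) ⊖ n     ≡⟨ ℤ.⊖-≥ (m≤n+m n m) ⟩
  + (m + n ∸ n)   ≡⟨ cong +_ (m+n∸n≡m m n) ⟩
  + m             ∎)
  where open ≡-Reasoning

theorem1 : ∀ (k n : ℕ) → 2 ≤ k → k ≤ n →
    ∃[ s ] ∃[ τ ]
    IsS n (n ∸ k) k s ×
    IsT n (suc k) k τ ×
    (+ s ≡ + (n C k) - + τ) ×
    (k ≤ n ∸ 1 →
    ∃[ c ]
    IsC n (n ∸ k) (n ∸ k ∸ 1) c ×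
    τ ≡ c ×
    (+ c ≡ + (n C k) - + s))
theorem1 k n 2≤k k≤n
  -- The maximum `s` is attained by the monotone formula of a minimum Turán system, so no search
  -- over formulas is made.
  with 𝒮 , turán , minimal ← minimalSystem {n = n} {k = k} (Turán? (suc k))
         (λ xs⊆ys turán Q ∣Q∣ → let _ , A∈ , A⊆Q = find (turán Q ∣Q∣) in lose (xs⊆ys A∈) A⊆Q)
         (subsets-Turán (n≤1+n k))
  = s , τ
  , ((F , monotoneCNF-width 𝒮 , monotoneCNF-admissible k≤n turán , refl) , maximal)
  , isT
  , m+n≡o⇒+m≡+o-+n s τ s+τ
  , λ k≤n∸1 → τ
    -- `IsT⇒IsC` with `q` equal to `suc k` yields `n ∸ suc k`, which is rewritten as `n ∸ k ∸ 1`.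
    , subst (λ j → IsC n (n ∸ k) j τ) (sym (trans (∸-+-assoc n k 1) (cong (n ∸_) (+-comm k 1))))
        (IsT⇒IsC (k<n k≤n∸1) k≤n isT)
    , refl
    , m+n≡o⇒+m≡+o-+n τ s (trans (+-comm τ s) s+τ)
  where
  F : CNF n
  F = monotoneCNF (sets 𝒮)
  s τ : ℕ
  s = length (sat (n ∸ k) F)
  τ = size 𝒮
  -- Assignments of weight `n ∸ k` are counted, so symmetry of the binomial coefficient is applied.
  sat+unsat′ : ∀ F → length (sat (n ∸ k) F) + length (unsat (n ∸ k) F) ≡ n C k
  sat+unsat′ F = trans (sat+unsat (n ∸ k) F) (sym (nCk≡nC[n∸k] k≤n))
  s+τ : s + τ ≡ n C k
  s+τ = trans (cong (λ m → s + m) (sym (length-unsat-monotoneCNF k≤n 𝒮))) (sat+unsat′ F)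
  isT : IsT n (suc k) k τ
  isT = (𝒮 , turán , refl) , λ { _ (𝒮′ , turán′ , refl) → minimal 𝒮′ turán′ }
  k<n : k ≤ n ∸ 1 → k < n
  -- Passing from `k ≤ n ∸ 1` to `k < n` takes `1 ≤ n`, which follows from `2 ≤ k ≤ n`.
  k<n k≤n∸1 = subst (suc k ≤_) (m+[n∸m]≡n (≤-trans (<⇒≤ 2≤k) k≤n)) (s≤s k≤n∸1)
  -- Each competitor `G` yields a Turán system, so at least `τ` assignments of weight `n ∸ k`
  -- falsify it; the total being fixed, at most `s` satisfy it.
  maximal : ∀ j → ∃[ G ] (k -CNF) {n} G × Admissible (n ∸ k) G × length (sat (n ∸ k) G) ≡ j → j ≤ s
  maximal _ (G , kCNF , admissible , refl) = +-cancelʳ-≤ τ _ s (begin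
    length (sat (n ∸ k) G) + τ                         ≤⟨ +-monoʳ-≤ _ τ≤unsat ⟩
    length (sat (n ∸ k) G) + length (unsat (n ∸ k) G) ≡⟨ trans (sat+unsat′ G) (sym s+τ) ⟩
    s + τ                                              ∎)
    where
    open ≤-Reasoning
    τ≤unsat : τ ≤ length (unsat (n ∸ k) G)
    τ≤unsat = subst (τ ≤_) (length-map ∁ (unsat (n ∸ k) G))
      (minimal (unsatSystem k≤n G) (unsatSystem-Turán k≤n G kCNF admissible))
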